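{- Let $n\geq 2$ be an integer and let $L$ be a quasigroup of order $n$ with underlying set $I_n=\{1,2,\ldots,n\}$, whose product of $x$ and $y$ is written $xy$. Let $\Gamma_2$ be the digraph with vertex set $I_n\times I_n\times\mathbb{Z}_3$ whose darts (arcs) are exactly the following: \begin{itemize} \item $(x,y,i)\mapsto(z,y,i)$ for all $i\in\mathbb{Z}_3$, $x,y,z\in I_n$, $x\neq z$; \item $(x,y,i)\mapsto(x,z,i)$ for all $i\in\mathbb{Z}_3$, $x,y,z\in I_n$, $y\neq z$; \item $(x,y,i)\mapsto(xy,z,i+1)$ for all $i\in\mathbb{Z}_3$, $x,y,z\in I_n$; \item $(x,y,i)\mapsto(z,yx,i-1)$ for all $i\in\mathbb{Z}_3$, $x,y,z\in I_n$. \end{itemize} Then $\Gamma_2$ is a directed strongly regular graph with parameter set $(3n^2,\,4n-2,\,2n,\,n,\,4)$.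
   Context: A quasigroup is a set $Q$ with a binary operation such that for all $a,b\in Q$ each of the equations $ax=b$ and $ya=b$ has a unique solution in $Q$; equivalently, its multiplication table is a Latin square, $xy$ being the symbol in row $x$ and column $y$. (In particular loops, i.e. quasigroups with an identity element, are allowed.) A directed strongly regular graph (DSRG) with parameter set $(N,k,t,\lambda,\mu)$ (in this order) is a loopless directed graph on $N$ vertices that is regular of valency $k$ (every vertex has in-degree and out-degree $k$), such that every vertex is incident with exactly $t$ undirected edges (an undirected edge is a pair of opposite arcs), and for any two distinct vertices $x,y$ the number of directed paths of length 2 from $x$ to $y$ is $\lambda$ if there is an arc from $x$ to $y$ and $\mu$ otherwise. Equivalently, its adjacency matrix $A$ (with zero diagonal) satisfies $AJ=JA=kJ$ and $A^2=tI+\lambda A+\mu(J-I-A)$, where $J$ is the all-one matrix and $I$ the identity matrix. -}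

module Defs where

open import Algebra.Core using (Op₂)
open import Algebra.Structures using (IsQuasigroup)
open import Data.Fin.Base using (Fin; toℕ)
open import Data.List.Base using (List; length)
open import Data.List.Membership.Propositional using (_∈_)
open import Data.List.Relation.Unary.Unique.Propositional using (Unique)
open import Data.Nat.Base using (ℕ; _+_)
open import Data.Nat.DivMod using (_mod_)
open import Data.Product.Base using (_×_; _,_; proj₁; proj₂; ∃-syntax)
open import Data.Product using (∃!)
open import Data.Unit.Base using (⊤)
open import Function.Bundles using (_⇔_)
open import Level using (0ℓ)
open import Relation.Binary.Core using (Rel)
open import Relation.Binary.PropositionalEquality
  using (_≡_; _≢_; refl; sym; trans; cong; cong₂; isEquivalence)
open import Relation.Nullary.Negation.Core using (¬_)

-- Exactly m elements satisfy P.  Elements are counted, not proofs of P: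
-- they are listed without repetition.
Exactly : {V : Set} → ℕ → (V → Set) → Set
Exactly {V} m P =
  ∃[ xs ] Unique {A = V} xs × (∀ v → v ∈ xs ⇔ P v) × length xs ≡ m

-- A digraph without multiple arcs is a relation on its vertices, so a
-- directed path of length 2 from x to y is determined by its middle vertex.
record IsDSRG {V : Set} (_⟶_ : Rel V 0ℓ) (N k t lam mu : ℕ) : Set where
  field
    order       : Exactly {V} N (λ _ → ⊤)
    loopless    : ∀ x → ¬ (x ⟶ x)
    outDegree   : ∀ x → Exactly k (λ y → x ⟶ y)
    inDegree    : ∀ x → Exactly k (λ y → y ⟶ x)
    undirected  : ∀ x → Exactly t (λ y → (x ⟶ y) × (y ⟶ x))
    adjacent    : ∀ x y → x ≢ y → x ⟶ y →
                  Exactly lam (λ z → (x ⟶ z) × (z ⟶ y))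
    nonadjacent : ∀ x y → x ≢ y → ¬ (x ⟶ y) →
                  Exactly mu (λ z → (x ⟶ z) × (z ⟶ y))

ℤ₃ : Set
ℤ₃ = Fin 3

-- i ⁺ = i + 1 and i ⁻ = i - 1 (that is, i + 2) modulo 3.
_⁺ _⁻ : ℤ₃ → ℤ₃
i ⁺ = (toℕ i + 1) mod 3
i ⁻ = (toℕ i + 2) mod 3

-- The set I_n is represented by Fin n.
Vertex : ℕ → Set
Vertex n = Fin n × Fin n × ℤ₃

data Γ₂ {n : ℕ} (_∙_ : Op₂ (Fin n)) : Rel (Vertex n) 0ℓ where
  first  : ∀ i x y z → x ≢ z → Γ₂ _∙_ (x , y , i) (z , y , i)
  second : ∀ i x y z → y ≢ z → Γ₂ _∙_ (x , y , i) (x , z , i)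
  next   : ∀ i x y z → Γ₂ _∙_ (x , y , i) (x ∙ y , z , i ⁺)
  prev   : ∀ i x y z → Γ₂ _∙_ (x , y , i) (z , y ∙ x , i ⁻)

-- The library presents quasigroups by division operations.  The next two
-- lemmas check that, over _≡_, such divisions exist exactly when the equations
-- a ∙ x ≡ b and y ∙ a ≡ b are uniquely solvable.
UniquelySolvable : {A : Set} → Op₂ A → Set
UniquelySolvable _∙_ =
  ∀ a b → ∃! _≡_ (λ x → a ∙ x ≡ b) × ∃! _≡_ (λ y → y ∙ a ≡ b)

isQuasigroup⇒uniquelySolvable :
  {A : Set} {_∙_ _\\_ _//_ : Op₂ A} →
  IsQuasigroup _≡_ _∙_ _\\_ _//_ → UniquelySolvable _∙_
isQuasigroup⇒uniquelySolvable {_\\_ = _\\_} {_//_} Q a b =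
    (a \\ b , leftDividesˡ a b ,
      λ {x} eq → trans (cong (a \\_) (sym eq)) (leftDividesʳ a x))
  , (b // a , rightDividesˡ a b ,
      λ {y} eq → trans (cong (_// a) (sym eq)) (rightDividesʳ a y))
  where open IsQuasigroup Q
          using (leftDividesˡ; leftDividesʳ; rightDividesˡ; rightDividesʳ)

uniquelySolvable⇒isQuasigroup :
  {A : Set} {_∙_ : Op₂ A} → UniquelySolvable _∙_ →
  ∃[ left ] ∃[ right ] IsQuasigroup _≡_ _∙_ left right
uniquelySolvable⇒isQuasigroup {_∙_ = _∙_} u =
    (λ a b → proj₁ (proj₁ (u a b)))
  , (λ b a → proj₁ (proj₂ (u a b)))
  , record
    { isMagma      = record { isEquivalence = isEquivalence ; ∙-cong = cong₂ _∙_ }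
    ; \\-cong      = cong₂ _
    ; //-cong      = cong₂ _
    ; leftDivides  = (λ a b → proj₁ (proj₂ (proj₁ (u a b))))
                   , (λ a x → proj₂ (proj₂ (proj₁ (u a (a ∙ x)))) refl)
    ; rightDivides = (λ a b → proj₁ (proj₂ (proj₂ (u a b))))
                   , (λ a y → proj₂ (proj₂ (proj₂ (u a (y ∙ a)))) refl)
    }

-- Relative to the layer i of a vertex, every vertex lies in the layer i, i ⁺ or
-- i ⁻, and between given layers the arcs form a relation on the n × n grid that
-- does not depend on i: a rook move, x ∙ y ≡ u or y ∙ x ≡ v.  With B, N, P for
-- the corresponding blocks of the adjacency matrix A, the blocks of A² are
-- B² + NP + PN on the diagonal, BN + NB + P² from i to i ⁺ and BP + PB + N²
-- from i to i ⁻.  Unique divisibility gives NP = PN = N² = P² = J,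
-- BN = 2(J - N) and NB = J + (n - 2)N; BP and PB follow since transposing the
-- grid exchanges N and P.
module Submission where

open import Defs
open import Algebra.Core using (Op₂)
open import Algebra.Structures using (IsQuasigroup)
open import Data.Fin.Base
  using (Fin; zero; suc; punchIn; punchOut; combine; remQuot)
open import Data.Fin.Properties
  using (_≟_; punchIn-injective; punchInᵢ≢i; punchIn-punchOut;
         combine-remQuot; remQuot-combine)
open import Data.List.Base using ([]; _∷_; _++_; map; allFin)
open import Data.List.Membership.Propositional using (_∈_)
open import Data.List.Membership.Propositional.Properties
  using (∈-map⁺; ∈-map⁻; ∈-allFin; ++-∈⇔)
open import Data.List.Properties using (length-map; length-++; length-tabulate)
open import Data.List.Relation.Unary.All using ([]; _∷_)
open import Data.List.Relation.Unary.AllPairs using ([]; _∷_)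
open import Data.List.Relation.Unary.Any using (here; there)
import Data.List.Relation.Unary.Unique.Propositional.Properties as Unique
open import Data.Nat.Base using (ℕ; suc; _+_; _*_; _∸_; _^_; _≥_; s≤s)
open import Data.Nat.Tactic.RingSolver using (solve-∀)
open import Data.Product.Base
  using (_×_; _,_; proj₁; proj₂; ∃-syntax; swap; uncurry)
open import Data.Product.Function.NonDependent.Propositional using (_×-⇔_)
open import Data.Sum.Base using (_⊎_; inj₁; inj₂; [_,_])
open import Data.Sum.Function.Propositional using (_⊎-⇔_)
open import Data.Unit.Base using (⊤)
open import Function.Base using (id; _∘_; const)
open import Function.Bundles using (_⇔_; mk⇔; Equivalence)
open import Function.Construct.Composition using (_⇔-∘_)
open import Function.Construct.Identity using (⇔-id)
open import Function.Construct.Symmetry using (⇔-sym)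
open import Function.Definitions using (Injective)
open import Level using (0ℓ)
open import Relation.Binary.Core using (Rel)
open import Relation.Binary.PropositionalEquality
  using (_≡_; _≢_; refl; sym; trans; cong; subst; ≢-sym)
open import Relation.Nullary.Decidable.Core using (yes; no)
open import Relation.Nullary.Negation.Core using (¬_; contradiction)

open Equivalence using (to; from)

-- Counting the solutions of a predicate.

private
  variable
    A B : Set
    P Q : A → Set
    m n k l : ℕ

-- `f` only has to reach the solutions of `Q`, not all of `B`, so a solution set can be counted
-- through any injective parametrisation of it. Injectivity keeps the mapped list free of
-- repetitions.
exactly-image :
  (f : A → B) → Injective _≡_ _≡_ f → (∀ {a} → P a ⇔ Q (f a)) →
  (∀ {b} → Q b → ∃[ a ] f a ≡ b) → Exactly m P → Exactly m Q
exactly-image {Q = Q} f f-inj P⇔Q∘f preimage (xs , uniq , xs⇔P , len) =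
    map f xs
  , Unique.map⁺ f-inj uniq
  , (λ b → mk⇔
      (λ b∈ → let a , a∈ , b≡fa = ∈-map⁻ f b∈
              in subst Q (sym b≡fa) (to P⇔Q∘f (to (xs⇔P a) a∈)))
      (λ q → member (preimage q) q))
  , trans (length-map f xs) len
  where
  member : ∀ {b} → ∃[ a ] f a ≡ b → Q b → b ∈ map f xs
  member (a , refl) q = ∈-map⁺ f (from (xs⇔P a) (from P⇔Q∘f q))

exactly-cong : (∀ {a} → P a ⇔ Q a) → Exactly m P → Exactly m Q
exactly-cong P⇔Q = exactly-image id id P⇔Q (λ _ → _ , refl)

exactly-⊎ : (∀ {a} → P a → ¬ Q a) → Exactly k P → Exactly l Q →
            Exactly (k + l) (λ a → P a ⊎ Q a)
exactly-⊎ disjoint (xs , xs! , xs⇔P , refl) (ys , ys! , ys⇔Q , refl) =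
    xs ++ ys
  , Unique.++⁺ xs! ys!
      (λ {a} (a∈xs , a∈ys) → disjoint (to (xs⇔P a) a∈xs) (to (ys⇔Q a) a∈ys))
  , (λ a → (xs⇔P a ⊎-⇔ ys⇔Q a) ⇔-∘ ++-∈⇔)
  , length-++ xs

exactly-0 : (∀ {a} → ¬ P a) → Exactly 0 P
exactly-0 ¬P = [] , [] , (λ _ → mk⇔ (λ ()) (λ p → contradiction p ¬P)) , refl

exactly-1 : ∀ {a : A} → P a → (∀ {b} → P b → b ≡ a) → Exactly 1 P
exactly-1 {a = a} pa unique =
    a ∷ [] , [] ∷ []
  , (λ b → mk⇔ (λ { (here refl) → pa }) (here ∘ unique)) , refl

exactly-2 : ∀ {a b : A} → a ≢ b → P a → P b →
            (∀ {c} → P c → c ≡ a ⊎ c ≡ b) → Exactly 2 P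
exactly-2 {a = a} {b} a≢b pa pb either =
    a ∷ b ∷ [] , (a≢b ∷ []) ∷ [] ∷ []
  , (λ c → mk⇔ (λ { (here refl) → pa ; (there (here refl)) → pb })
               (member ∘ either))
  , refl
  where
  member : ∀ {c} → c ≡ a ⊎ c ≡ b → c ∈ a ∷ b ∷ []
  member (inj₁ c≡a) = here c≡a
  member (inj₂ c≡b) = there (here c≡b)

exactly-Fin : ∀ n → Exactly {Fin n} n (λ _ → ⊤)
exactly-Fin n =
  allFin n , Unique.allFin⁺ n , (λ a → mk⇔ _ (λ _ → ∈-allFin a)) ,
  length-tabulate id

exactly-≢ : (x : Fin (suc n)) → Exactly n (x ≢_)
exactly-≢ {n} x = exactly-image
  (punchIn x) (punchIn-injective x _ _)
  (λ {a} → mk⇔ (λ _ → ≢-sym (punchInᵢ≢i x a)) _)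
  (λ x≢b → punchOut x≢b , punchIn-punchOut x≢b)
  (exactly-Fin n)

-- Removing `x` by `punchIn x` leaves a copy of `Fin (suc n)` in which `y` sits at `punchOut x≢y`; a
-- second removal finishes the count.
exactly-≢≢ : {x y : Fin (suc (suc n))} → x ≢ y →
             Exactly n (λ z → x ≢ z × z ≢ y)
exactly-≢≢ {n} {x} {y} x≢y = exactly-image
  (punchIn x) (punchIn-injective x _ _)
  (λ {a} → mk⇔
    (λ y′≢a → ≢-sym (punchInᵢ≢i x a) ,
      λ eq → y′≢a (punchIn-injective x _ _ (trans (punchIn-punchOut x≢y) (sym eq))))
    (λ (_ , ≢y) y′≡a → ≢y (trans (cong (punchIn x) (sym y′≡a)) (punchIn-punchOut x≢y))))
  (λ (x≢b , _) → punchOut x≢b , punchIn-punchOut x≢b)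
  (exactly-≢ (punchOut x≢y))

-- Counting on the grid.

Grid : ℕ → Set
Grid n = Fin n × Fin n

exactly-Grid : ∀ n → Exactly {Grid n} (n * n) (λ _ → ⊤)
exactly-Grid n = exactly-image
  (remQuot n)
  (λ {a} {b} eq → trans (sym (combine-remQuot {n} n a))
                 (trans (cong (uncurry combine) eq) (combine-remQuot {n} n b)))
  (⇔-id ⊤)
  (λ {(x , y)} _ → combine x y , remQuot-combine x y)
  (exactly-Fin (n * n))

exactly-graph : {P : Fin n → Set} {Q : Grid n → Set} (f : Fin n → Fin n) →
  (∀ {u} → P u ⇔ Q (u , f u)) → (∀ {u v} → Q (u , v) → f u ≡ v) →
  Exactly m P → Exactly m Q
exactly-graph f P⇔Q functional = exactly-image
  (λ u → u , f u) (cong proj₁) P⇔Q (λ {(u , _)} q → u , cong (u ,_) (functional q))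

exactly-transpose : {P Q : Grid n → Set} → (∀ {u v} → P (u , v) ⇔ Q (v , u)) →
  Exactly m P → Exactly m Q
exactly-transpose P⇔Q = exactly-image swap (cong swap) P⇔Q (λ _ → _ , refl)

-- Rook moves and the block products `B²` and `NB`.

data Rook {n : ℕ} : Rel (Grid n) 0ℓ where
  move₁ : ∀ {x u y} → x ≢ u → Rook (x , y) (u , y)
  move₂ : ∀ {x y v} → y ≢ v → Rook (x , y) (x , v)

Rook-sym : {p q : Grid n} → Rook p q → Rook q p
Rook-sym (move₁ x≢u) = move₁ (≢-sym x≢u)
Rook-sym (move₂ y≢v) = move₂ (≢-sym y≢v)

Rook-swap : {p q : Grid n} → Rook p q → Rook (swap p) (swap q)
Rook-swap (move₁ x≢u) = move₂ x≢u
Rook-swap (move₂ y≢v) = move₁ y≢v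

Rook-irrefl : {p : Grid n} → ¬ Rook p p
Rook-irrefl (move₁ x≢x) = x≢x refl
Rook-irrefl (move₂ y≢y) = y≢y refl

Rook-comm : {p q : Grid n} → Rook p q ⇔ Rook q p
Rook-comm = mk⇔ Rook-sym Rook-sym

Rook-transpose : {p q : Grid n} → Rook p q ⇔ Rook (swap p) (swap q)
Rook-transpose = mk⇔ Rook-swap Rook-swap

rook-degree : (p : Grid (suc m)) → Exactly (m + m) (Rook p)
rook-degree (x , y) = exactly-cong
  (mk⇔ [ (λ { (x≢u , refl) → move₁ x≢u }) , (λ { (refl , y≢v) → move₂ y≢v }) ]
       (λ { (move₁ x≢u) → inj₁ (x≢u , refl) ; (move₂ y≢v) → inj₂ (refl , y≢v) }))
  (exactly-⊎ {P = λ (u , v) → x ≢ u × y ≡ v} {Q = λ (u , v) → x ≡ u × y ≢ v}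
    (λ (x≢u , _) (x≡u , _) → x≢u x≡u)
    (exactly-graph (const y) (mk⇔ (_, refl) proj₁) proj₂ (exactly-≢ x))
    (exactly-image (x ,_) (cong proj₂) (mk⇔ (refl ,_) proj₂)
      (λ { (refl , _) → _ , refl }) (exactly-≢ y)))

-- A first move off the common line changes the second coordinate, and a single further move cannot
-- restore it and also change `x` to `x′`. So the middle cell stays on the line and avoids both
-- ends.
rook-paths-row : {x x′ y : Fin (suc (suc m))} → x ≢ x′ →
  Exactly m (λ r → Rook (x , y) r × Rook r (x′ , y))
rook-paths-row {y = y} x≢x′ = exactly-graph (const y)
  (mk⇔ (λ (x≢u , u≢x′) → move₁ x≢u , move₁ u≢x′)
       (λ { (move₁ x≢u , move₁ u≢x′) → x≢u , u≢x′
          ; (move₁ x≢u , move₂ y≢y) → contradiction refl y≢y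
          ; (move₂ y≢y , _) → contradiction refl y≢y }))
  (λ { (move₁ x≢u , _) → refl
     ; (move₂ y≢v , move₁ _) → refl
     ; (move₂ y≢v , move₂ _) → contradiction refl x≢x′ })
  (exactly-≢≢ x≢x′)

rook-paths-adjacent : {p q : Grid (suc (suc m))} → Rook p q →
  Exactly m (λ r → Rook p r × Rook r q)
rook-paths-adjacent (move₁ x≢u) = rook-paths-row x≢u
rook-paths-adjacent (move₂ y≢v) = exactly-transpose
  (Rook-transpose ×-⇔ Rook-transpose) (rook-paths-row y≢v)

-- The two middle cells are the remaining corners of the rectangle spanned by the endpoints.
rook-paths-nonadjacent : {x y x′ y′ : Fin n} → x ≢ x′ → y ≢ y′ →
  Exactly 2 (λ r → Rook (x , y) r × Rook r (x′ , y′))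
rook-paths-nonadjacent x≢x′ y≢y′ = exactly-2
  (λ eq → x≢x′ (sym (cong proj₁ eq)))
  (move₁ x≢x′ , move₂ y≢y′)
  (move₂ y≢y′ , move₁ x≢x′)
  (λ { (move₁ _ , move₁ _) → contradiction refl y≢y′
     ; (move₁ _ , move₂ _) → inj₁ refl
     ; (move₂ _ , move₁ _) → inj₂ refl
     ; (move₂ _ , move₂ _) → contradiction refl x≢x′ })

-- An entry of `NB` where `N` has a 1: the middle cell lies on the same line as the target `(x , y)`
-- and may be any other cell of it.
next-rook-adjacent : {c x y : Fin (suc m)} → c ≡ x →
  Exactly {Grid (suc m)} m (λ (u , v) → c ≡ u × Rook (u , v) (x , y))
next-rook-adjacent {c = c} {y = y} refl = exactly-image
  (c ,_) (cong proj₂)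
  (mk⇔ (λ y≢v → refl , move₂ (≢-sym y≢v))
       (λ { (refl , move₁ c≢c) → contradiction refl c≢c
          ; (refl , move₂ v≢y) → ≢-sym v≢y }))
  (λ { {_ , v} (refl , _) → v , refl })
  (exactly-≢ y)

-- An entry of `NB` where `N` has a 0: the rook must still change the first coordinate, so the
-- middle cell is `(c , y)`.
next-rook-nonadjacent : {c x y : Fin n} → c ≢ x →
  Exactly {Grid n} 1 (λ (u , v) → c ≡ u × Rook (u , v) (x , y))
next-rook-nonadjacent c≢x = exactly-1 (refl , move₁ c≢x)
  (λ { (refl , move₁ _) → refl ; (refl , move₂ _) → contradiction refl c≢x })

non-rook : {x y x′ y′ : Fin n} → (x , y) ≢ (x′ , y′) →
  ¬ Rook (x , y) (x′ , y′) → x ≢ x′ × y ≢ y′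
non-rook {x = x} {y} {x′} {y′} p≢q ¬rook with x ≟ x′ | y ≟ y′
... | yes refl | yes refl = contradiction refl p≢q
... | yes refl | no y≢y′  = contradiction (move₂ y≢y′) ¬rook
... | no x≢x′  | yes refl = contradiction (move₁ x≢x′) ¬rook
... | no x≢x′  | no y≢y′  = x≢x′ , y≢y′

-- The three layers.

⁺≢ : ∀ i → i ⁺ ≢ i
⁺≢ zero ()
⁺≢ (suc zero) ()
⁺≢ (suc (suc zero)) ()

⁻≢ : ∀ i → i ⁻ ≢ i
⁻≢ zero ()
⁻≢ (suc zero) ()
⁻≢ (suc (suc zero)) ()

⁺≢⁻ : ∀ i → i ⁺ ≢ i ⁻
⁺≢⁻ zero ()
⁺≢⁻ (suc zero) ()
⁺≢⁻ (suc (suc zero)) ()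

-- This identity and the next three are oriented to serve as the layer hypotheses of `arc-above` and
-- `arc-below`, for the arcs that leave layer `i ⁺` or `i ⁻`.
⁺⁻ : ∀ i → i ≡ i ⁺ ⁻
⁺⁻ zero = refl
⁺⁻ (suc zero) = refl
⁺⁻ (suc (suc zero)) = refl

⁻⁺ : ∀ i → i ≡ i ⁻ ⁺
⁻⁺ zero = refl
⁻⁺ (suc zero) = refl
⁻⁺ (suc (suc zero)) = refl

⁺⁺ : ∀ i → i ⁻ ≡ i ⁺ ⁺
⁺⁺ zero = refl
⁺⁺ (suc zero) = refl
⁺⁺ (suc (suc zero)) = refl

⁻⁻ : ∀ i → i ⁺ ≡ i ⁻ ⁻
⁻⁻ zero = refl
⁻⁻ (suc zero) = refl
⁻⁻ (suc (suc zero)) = refl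

data Relative (i : ℤ₃) : ℤ₃ → Set where
  same  : Relative i i
  above : Relative i (i ⁺)
  below : Relative i (i ⁻)

relative : ∀ i j → Relative i j
relative zero             zero             = same
relative zero             (suc zero)       = above
relative zero             (suc (suc zero)) = below
relative (suc zero)       zero             = below
relative (suc zero)       (suc zero)       = same
relative (suc zero)       (suc (suc zero)) = above
relative (suc (suc zero)) zero             = above
relative (suc (suc zero)) (suc zero)       = below
relative (suc (suc zero)) (suc (suc zero)) = same

at : ℤ₃ → Grid n → Vertex n
at i (x , y) = x , y , i

exactly-layer : {P : Vertex n → Set} (i : ℤ₃) →
  Exactly m (λ p → P (at i p)) →
  Exactly m (λ (x , y , j) → j ≡ i × P (x , y , j))
exactly-layer i = exactly-image
  (at i) (λ { refl → refl }) (mk⇔ (refl ,_) proj₂)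
  (λ { {x , y , _} (refl , _) → (x , y) , refl })

-- The layers `i`, `i ⁺`, `i ⁻` partition the vertices. For paths, with the middle vertex being
-- counted, the three summands are the three block products in one block of `A²`.
exactly-layers : ∀ {c₀ c₁ c₂} (P : Vertex n → Set) (i : ℤ₃) →
  Exactly c₀ (λ p → P (at i p)) →
  Exactly c₁ (λ p → P (at (i ⁺) p)) →
  Exactly c₂ (λ p → P (at (i ⁻) p)) →
  Exactly (c₀ + (c₁ + c₂)) P
exactly-layers P i e₀ e₁ e₂ = exactly-cong
  (λ {(x , y , j)} → mk⇔ [ proj₂ , [ proj₂ , proj₂ ] ] (locate (relative i j)))
  (exactly-⊎
    (λ { (refl , _) (inj₁ (eq , _)) → ⁺≢ i (sym eq)
       ; (refl , _) (inj₂ (eq , _)) → ⁻≢ i (sym eq) })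
    (exactly-layer {P = P} i e₀)
    (exactly-⊎ (λ { (refl , _) (eq , _) → ⁺≢⁻ i eq })
      (exactly-layer {P = P} (i ⁺) e₁) (exactly-layer {P = P} (i ⁻) e₂)))
  where
  locate : ∀ {x y j} → Relative i j → P (x , y , j) →
    (j ≡ i × P (x , y , j)) ⊎ (j ≡ i ⁺ × P (x , y , j)) ⊎ (j ≡ i ⁻ × P (x , y , j))
  locate same  p = inj₁ (refl , p)
  locate above p = inj₂ (inj₁ (refl , p))
  locate below p = inj₂ (inj₂ (refl , p))

-- The blocks of the adjacency matrix.

module _ {n : ℕ} {_∙_ : Op₂ (Fin n)} where

  -- The target layer `j` is kept a variable so that matching on the arc unifies; the layer
  -- equations are then refuted or used separately.
  arc-cases : ∀ {i j x y u v} → Γ₂ _∙_ (x , y , i) (u , v , j) →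
    (j ≡ i × Rook (x , y) (u , v)) ⊎ (j ≡ i ⁺ × x ∙ y ≡ u) ⊎ (j ≡ i ⁻ × y ∙ x ≡ v)
  arc-cases (first _ _ _ _ x≢z)  = inj₁ (refl , move₁ x≢z)
  arc-cases (second _ _ _ _ y≢z) = inj₁ (refl , move₂ y≢z)
  arc-cases (next _ _ _ _)       = inj₂ (inj₁ (refl , refl))
  arc-cases (prev _ _ _ _)       = inj₂ (inj₂ (refl , refl))

  arc-same : ∀ {i x y u v} → Γ₂ _∙_ (x , y , i) (u , v , i) ⇔ Rook (x , y) (u , v)
  arc-same {i} = mk⇔ (rook ∘ arc-cases)
    (λ { (move₁ x≢u) → first _ _ _ _ x≢u ; (move₂ y≢v) → second _ _ _ _ y≢v })
    where
    rook : ∀ {R S T : Set} → (i ≡ i × R) ⊎ (i ≡ i ⁺ × S) ⊎ (i ≡ i ⁻ × T) → R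
    rook (inj₁ (_ , r))         = r
    rook (inj₂ (inj₁ (eq , _))) = contradiction (sym eq) (⁺≢ i)
    rook (inj₂ (inj₂ (eq , _))) = contradiction (sym eq) (⁻≢ i)

  arc-above : ∀ {i j x y u v} → j ≡ i ⁺ → Γ₂ _∙_ (x , y , i) (u , v , j) ⇔ x ∙ y ≡ u
  arc-above {i} refl = mk⇔ (product ∘ arc-cases) (λ { refl → next _ _ _ _ })
    where
    product : ∀ {R S T : Set} → (i ⁺ ≡ i × R) ⊎ (i ⁺ ≡ i ⁺ × S) ⊎ (i ⁺ ≡ i ⁻ × T) → S
    product (inj₁ (eq , _))        = contradiction eq (⁺≢ i)
    product (inj₂ (inj₁ (_ , s)))  = s
    product (inj₂ (inj₂ (eq , _))) = contradiction eq (⁺≢⁻ i)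

  arc-below : ∀ {i j x y u v} → j ≡ i ⁻ → Γ₂ _∙_ (x , y , i) (u , v , j) ⇔ y ∙ x ≡ v
  arc-below {i} refl = mk⇔ (product ∘ arc-cases) (λ { refl → prev _ _ _ _ })
    where
    product : ∀ {R S T : Set} → (i ⁻ ≡ i × R) ⊎ (i ⁻ ≡ i ⁺ × S) ⊎ (i ⁻ ≡ i ⁻ × T) → T
    product (inj₁ (eq , _))        = contradiction eq (⁻≢ i)
    product (inj₂ (inj₁ (eq , _))) = contradiction (sym eq) (⁺≢⁻ i)
    product (inj₂ (inj₂ (_ , t)))  = t

-- Counts from unique divisibility.

module Counts {n : ℕ} {_∙_ _\\_ _//_ : Op₂ (Fin n)}
              (Q : IsQuasigroup _≡_ _∙_ _\\_ _//_) where

  open IsQuasigroup Q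
    using (leftDividesˡ; leftDividesʳ; rightDividesˡ; rightDividesʳ)

  \\-unique : ∀ {a b x} → a ∙ x ≡ b → a \\ b ≡ x
  \\-unique refl = leftDividesʳ _ _

  //-unique : ∀ {a b y} → y ∙ a ≡ b → b // a ≡ y
  //-unique refl = rightDividesʳ _ _

  successors : ∀ c → Exactly {Grid n} n (λ (u , v) → c ≡ u)
  successors c = exactly-image (c ,_) (cong proj₂) (mk⇔ (const refl) _)
    (λ { {_ , v} refl → v , refl }) (exactly-Fin n)

  predecessors : ∀ c → Exactly {Grid n} n (λ (u , v) → u ∙ v ≡ c)
  predecessors c = exactly-graph (_\\ c) (mk⇔ (λ _ → leftDividesˡ _ c) _)
    \\-unique (exactly-Fin n)

  next-prev : ∀ c d → Exactly {Grid n} 1 (λ (u , v) → c ≡ u × v ∙ u ≡ d)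
  next-prev c d = exactly-1 (refl , rightDividesˡ c d)
    (λ { (refl , eq) → cong (c ,_) (sym (//-unique eq)) })

  next-next : ∀ c d → Exactly {Grid n} 1 (λ (u , v) → c ≡ u × u ∙ v ≡ d)
  next-next c d = exactly-1 (refl , leftDividesˡ c d)
    (λ { (refl , eq) → cong (c ,_) (sym (\\-unique eq)) })

  -- A zero entry of `BN`: in a Latin square no symbol recurs in a row or a column, so a rook move
  -- always changes the product.
  rook-next-adjacent : ∀ {x y c} → x ∙ y ≡ c →
    Exactly {Grid n} 0 (λ (u , v) → Rook (x , y) (u , v) × u ∙ v ≡ c)
  rook-next-adjacent x∙y≡c = exactly-0
    (λ { (move₁ x≢u , eq) → x≢u (trans (sym (//-unique x∙y≡c)) (//-unique eq))
       ; (move₂ y≢v , eq) → y≢v (trans (sym (\\-unique x∙y≡c)) (\\-unique eq)) })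

  -- The symbol `c` occurs once in row `x` and once in column `y`, and neither occurrence is at
  -- `(x , y)`.
  rook-next-nonadjacent : ∀ {x y c} → x ∙ y ≢ c →
    Exactly {Grid n} 2 (λ (u , v) → Rook (x , y) (u , v) × u ∙ v ≡ c)
  rook-next-nonadjacent {x} {y} {c} x∙y≢c = exactly-2
    (λ eq → x≢ (sym (cong proj₁ eq)))
    (move₁ x≢ , rightDividesˡ y c)
    (move₂ (λ eq → x∙y≢c (trans (cong (x ∙_) eq) (leftDividesˡ x c))) , leftDividesˡ x c)
    (λ { (move₁ _ , eq) → inj₁ (cong (_, y) (sym (//-unique eq)))
       ; (move₂ _ , eq) → inj₂ (cong (x ,_) (sym (\\-unique eq))) })
    where
    x≢ : x ≢ c // y
    x≢ eq = x∙y≢c (trans (cong (_∙ y) eq) (rightDividesˡ y c))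

-- Paths of length 2 and neighbours in `Γ₂`.

module Paths {n : ℕ} {_∙_ _\\_ _//_ : Op₂ (Fin n)}
             (Q : IsQuasigroup _≡_ _∙_ _\\_ _//_) where

  open Counts Q

  Path : Vertex n → Vertex n → Vertex n → Set
  Path p q r = Γ₂ _∙_ p r × Γ₂ _∙_ r q

  paths-same : ∀ {x y x′ y′ i} →
    Exactly m (λ r → Rook (x , y) r × Rook r (x′ , y′)) →
    Exactly (m + 2) (Path (x , y , i) (x′ , y′ , i))
  paths-same {x = x} {y} {x′} {y′} {i} rooks = exactly-layers _ i
    (exactly-cong (⇔-sym (arc-same ×-⇔ arc-same)) rooks)
    (exactly-cong (⇔-sym (arc-above refl ×-⇔ arc-below (⁺⁻ i)))
      (next-prev (x ∙ y) y′))
    (exactly-transpose (⇔-sym (arc-below refl ×-⇔ arc-above (⁻⁺ i)))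
      (next-prev (y ∙ x) x′))

  paths-above : ∀ {x y x′ y′ i} →
    Exactly {Grid n} k (λ (u , v) → Rook (x , y) (u , v) × u ∙ v ≡ x′) →
    Exactly {Grid n} l (λ (u , v) → x ∙ y ≡ u × Rook (u , v) (x′ , y′)) →
    Exactly (k + (l + 1)) (Path (x , y , i) (x′ , y′ , i ⁺))
  paths-above {x = x} {y} {x′} {y′} {i} rook-next next-rook = exactly-layers _ i
    (exactly-cong (⇔-sym (arc-same ×-⇔ arc-above refl)) rook-next)
    (exactly-cong (⇔-sym (arc-above refl ×-⇔ arc-same)) next-rook)
    -- Two steps down are one step up modulo 3; transposing turns `P²` into `N²`.
    (exactly-transpose (⇔-sym (arc-below refl ×-⇔ arc-below (⁻⁻ i)))
      (next-next (y ∙ x) y′))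

  -- Both hypotheses are stated on the transposed grid, where `P` becomes `N`, so the counts used
  -- for `paths-above` apply again.
  paths-below : ∀ {x y x′ y′ i} →
    Exactly {Grid n} k (λ (u , v) → Rook (y , x) (u , v) × u ∙ v ≡ y′) →
    Exactly {Grid n} l (λ (u , v) → y ∙ x ≡ u × Rook (u , v) (y′ , x′)) →
    Exactly (k + (1 + l)) (Path (x , y , i) (x′ , y′ , i ⁻))
  paths-below {x = x} {y} {x′} {y′} {i} rook-next next-rook = exactly-layers _ i
    (exactly-transpose
      (⇔-sym (arc-same ×-⇔ arc-below refl) ⇔-∘ (Rook-transpose ×-⇔ ⇔-id _))
      rook-next)
    (exactly-cong (⇔-sym (arc-above refl ×-⇔ arc-above (⁺⁺ i)))
      (next-next (x ∙ y) x′))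
    (exactly-transpose
      (⇔-sym (arc-below refl ×-⇔ arc-same) ⇔-∘ (⇔-id _ ×-⇔ Rook-transpose))
      next-rook)

  out-neighbours : ∀ p → Exactly m (Rook (proj₁ p , proj₁ (proj₂ p))) →
    Exactly (m + (n + n)) (Γ₂ _∙_ p)
  out-neighbours (x , y , i) rooks = exactly-layers _ i
    (exactly-cong (⇔-sym arc-same) rooks)
    (exactly-cong (⇔-sym (arc-above refl)) (successors (x ∙ y)))
    (exactly-transpose (⇔-sym (arc-below refl)) (successors (y ∙ x)))

  in-neighbours : ∀ p → Exactly m (Rook (proj₁ p , proj₁ (proj₂ p))) →
    Exactly (m + (n + n)) (λ q → Γ₂ _∙_ q p)
  in-neighbours (x , y , i) rooks = exactly-layers _ i
    (exactly-cong (⇔-sym arc-same ⇔-∘ Rook-comm) rooks)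
    -- An arc arriving from layer `i ⁺` goes down, hence is a `prev` arc.
    (exactly-transpose (⇔-sym (arc-below (⁺⁻ i))) (predecessors y))
    (exactly-cong (⇔-sym (arc-above (⁻⁺ i))) (predecessors x))

  -- Undirected edges at `p` are the closed paths of length 2, so this is the diagonal of `A²`. All
  -- rook moves are reversible, and each of the other two layers contributes one neighbour.
  mutual-neighbours : ∀ p → Exactly m (Rook (proj₁ p , proj₁ (proj₂ p))) →
    Exactly (m + 2) (λ q → Γ₂ _∙_ p q × Γ₂ _∙_ q p)
  mutual-neighbours (x , y , i) rooks = paths-same
    (exactly-cong (mk⇔ (λ r → r , Rook-sym r) proj₁) rooks)

-- The right-hand sides of order≡ and degree≡ are what 3 * n ^ 2 and
-- 4 * (2 + m) ∸ 2 compute to.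
order≡ : ∀ n → n * n + (n * n + n * n) ≡ 3 * (n * (n * 1))
order≡ = solve-∀

degree≡ : ∀ m → (1 + m) + (1 + m) + ((2 + m) + (2 + m)) ≡ m + 3 * (2 + m)
degree≡ = solve-∀

undirected≡ : ∀ m → (1 + m) + (1 + m) + 2 ≡ 2 * (2 + m)
undirected≡ = solve-∀

same≡ : ∀ m → m + 2 ≡ 2 + m
same≡ = solve-∀

above≡ : ∀ m → 1 + m + 1 ≡ 2 + m
above≡ = solve-∀

theorem5p1 : (n : ℕ) → n ≥ 2 →
    (_∙_ _\\_ _//_ : Op₂ (Fin n)) → IsQuasigroup _≡_ _∙_ _\\_ _//_ →
    IsDSRG (Γ₂ _∙_) (3 * n ^ 2) (4 * n ∸ 2) (2 * n) n 4
theorem5p1 n@(suc (suc m)) (s≤s (s≤s _)) _∙_ _\\_ _//_ Q = record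
  { order       = recount (order≡ n)
                    (exactly-layers _ zero (exactly-Grid n) (exactly-Grid n) (exactly-Grid n))
  ; loopless    = λ _ loop → Rook-irrefl (to arc-same loop)
  ; outDegree   = λ p → recount (degree≡ m) (out-neighbours p (rook-degree _))
  ; inDegree    = λ p → recount (degree≡ m) (in-neighbours p (rook-degree _))
  ; undirected  = λ p → recount (undirected≡ m) (mutual-neighbours p (rook-degree _))
  ; adjacent    = λ (_ , _ , i) (_ , _ , j) _ → adjacent (relative i j)
  ; nonadjacent = λ (_ , _ , i) (_ , _ , j) → nonadjacent (relative i j)
  }
  where
  open Counts Q
  open Paths Q

  recount : ∀ {A : Set} {P : A → Set} {k l} → k ≡ l → Exactly k P → Exactly l P
  recount {P = P} = subst (λ k → Exactly k P)

  adjacent : ∀ {x y x′ y′ i j} → Relative i j →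
    Γ₂ _∙_ (x , y , i) (x′ , y′ , j) → Exactly n (Path (x , y , i) (x′ , y′ , j))
  adjacent same arc =
    recount (same≡ m) (paths-same (rook-paths-adjacent (to arc-same arc)))
  adjacent above arc = let eq = to (arc-above refl) arc in
    recount (above≡ m) (paths-above (rook-next-adjacent eq) (next-rook-adjacent eq))
  adjacent below arc = let eq = to (arc-below refl) arc in
    -- The count `0 + (1 + (1 + m))` already reduces to `n`.
    paths-below (rook-next-adjacent eq) (next-rook-adjacent eq)

  nonadjacent : ∀ {x y x′ y′ i j} → Relative i j →
    (x , y , i) ≢ (x′ , y′ , j) → ¬ Γ₂ _∙_ (x , y , i) (x′ , y′ , j) →
    Exactly 4 (Path (x , y , i) (x′ , y′ , j))
  nonadjacent {i = i} same p≢q ¬arc = paths-same (uncurry rook-paths-nonadjacent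
    (non-rook (p≢q ∘ cong (at i)) (¬arc ∘ from arc-same)))
  nonadjacent above _ ¬arc = let neq = ¬arc ∘ from (arc-above refl) in
    -- The 4 is `2 + (1 + 1)`, from `BN`, `NB` and `P²` in this order.
    paths-above (rook-next-nonadjacent neq) (next-rook-nonadjacent neq)
  nonadjacent below _ ¬arc = let neq = ¬arc ∘ from (arc-below refl) in
    paths-below (rook-next-nonadjacent neq) (next-rook-nonadjacent neq)
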